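{- Let $\models$ be an intersective mixed consequence truth-relation on a finite set $V$ of truth values (constant expressive setting). Then $\models$ admits a G-conditional iff every minimal representation $\models_{\mathcal{D}_p^1,\mathcal{D}_c^1}\cap\dots\cap\models_{\mathcal{D}_p^K,\mathcal{D}_c^K}$ of it satisfies the following, where the list of sets of designated values is $\mathcal{D}_p^1,\mathcal{D}_c^1,\dots,\mathcal{D}_p^K,\mathcal{D}_c^K$: (DC1) for each set $\mathcal{D}_i$ in the list, either some truth value belongs to $\mathcal{D}_i$ and to no other set in the list, or $\mathcal{D}_i$ is included in another, distinct set of the list; (DC2) for every non-empty sublist $\mathcal{D}'_1,\dots,\mathcal{D}'_{n'}$ there is $x\in V$ such that for every set $\mathcal{D}_i$ of the list: $x\in\mathcal{D}_i$ iff $\exists i'$ with $\mathcal{D}'_{i'}\subseteq\mathcal{D}_i$; (N1) for $i\neq j$ there is no inclusion $\mathcal{D}_p^i\subseteq\mathcal{D}_p^j$ nor $\mathcal{D}_c^i\subseteq\mathcal{D}_c^j$; (N2) for all $i,j$: if $\mathcal{D}_p^i\subseteq\mathcal{D}_c^j$ then $\mathcal{D}_p^j\subseteq\mathcal{D}_c^i$, and if $\mathcal{D}_c^j\subseteq\mathcal{D}_p^i$ then $\mathcal{D}_c^i\subseteq\mathcal{D}_p^j$.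
   Context: $V$ contains distinct $1,0$; sets of designated values: $\mathcal{D}\subseteq V$, $1\in\mathcal{D}$, $0\notin\mathcal{D}$. $\gamma\models_{\mathcal{D}_p,\mathcal{D}_c}\delta$ iff ($\gamma\subseteq\mathcal{D}_p\Rightarrow\delta\cap\mathcal{D}_c\neq\emptyset$). An intersective mixed truth-relation is a finite intersection of such; a representation is a list of mixed relations whose intersection it is, minimal if of least possible length. Semantics: valuations mapping atoms to $V$, connectives interpreted by fixed truth functions, extended compositionally, every assignment to finitely many distinct atoms realized; constant expressive: every value is the constant value of some formula. $\Gamma\vdash\Delta$ iff $v(\Gamma)\models v(\Delta)$ for all $v$. A G-conditional is a binary connective $\to$ (interpreted by some truth function) with, for all $\Gamma,\Delta,A,B$: $\Gamma\vdash\{A\to B\}\cup\Delta$ iff $\Gamma\cup\{A\}\vdash\{B\}\cup\Delta$; and $\Gamma\cup\{A\to B\}\vdash\Delta$ iff ($\Gamma\vdash\{A\}\cup\Delta$ and $\Gamma\cup\{B\}\vdash\Delta$). -}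

module Defs where

open import Data.Fin using (Fin)
open import Data.Fin.Subset using (Subset; _∈_; _∉_; _⊆_)
open import Data.List using (List; []; _∷_; length; lookup; concatMap)
open import Data.List.Membership.Propositional using () renaming (_∈_ to _∈ₗ_)
open import Data.List.Relation.Binary.Sublist.Propositional using () renaming (_⊆_ to _⊑_)
open import Data.List.Relation.Unary.All using (All)
open import Data.List.Relation.Unary.Any using (Any)
open import Data.Nat using (ℕ; _≤_)
open import Data.Product using (_×_; ∃; ∃-syntax)
open import Data.Sum using (_⊎_)
open import Data.Vec using (Vec; []; _∷_)
open import Function.Bundles using (_⇔_)
open import Function.Definitions using (Injective)
open import Level using (0ℓ)
open import Relation.Binary.Core using (Rel)
open import Relation.Binary.PropositionalEquality using (_≡_; _≢_)
open import Relation.Nullary using (¬_)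
open import Relation.Unary using (Pred; ｛_｝; _∪_; _∩_; Empty) renaming (_∈_ to _∈ₚ_; _⊆_ to _⊆ₚ_)

-- The finite set V of truth values is Fin n.  Designated sets are decidable
-- (Subset n), but the arguments of a truth-relation are arbitrary predicates,
-- since the set of values taken by an arbitrary set of formulas need not be
-- decidable.

TruthRelation : ℕ → Set₁
TruthRelation n = Rel (Pred (Fin n) 0ℓ) 0ℓ

record DesignatedSet {n : ℕ} (𝟙 𝟘 : Fin n) : Set where
  field
    values : Subset n
    𝟙∈     : 𝟙 ∈ values
    𝟘∉     : 𝟘 ∉ values

open DesignatedSet public

record MixedRelation {n : ℕ} (𝟙 𝟘 : Fin n) : Set where
  field
    premiseDesignated    : DesignatedSet 𝟙 𝟘
    conclusionDesignated : DesignatedSet 𝟙 𝟘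

  Dp : Subset n
  Dp = values premiseDesignated

  Dc : Subset n
  Dc = values conclusionDesignated

open MixedRelation public

private
  variable
    n : ℕ
    𝟙 𝟘 : Fin n

⟪_⟫ : Subset n → Pred (Fin n) 0ℓ
⟪ D ⟫ x = x ∈ D

-- "δ ∩ Dc ≠ ∅" is read literally, as the negation of emptiness.  This makes
-- every intersective mixed relation stable under double negation, so that
-- undecidable γ and δ need no appeal to classical axioms.

MixedHolds : MixedRelation {n} 𝟙 𝟘 → Rel (Pred (Fin n) 0ℓ) 0ℓ
MixedHolds M γ δ = γ ⊆ₚ ⟪ Dp M ⟫ → ¬ Empty (δ ∩ ⟪ Dc M ⟫)

Represents : List (MixedRelation {n} 𝟙 𝟘) → TruthRelation n → Set₁
Represents L _⊨_ = ∀ γ δ → (γ ⊨ δ) ⇔ All (λ M → MixedHolds M γ δ) L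

IsIntersectiveMixed : (𝟙 𝟘 : Fin n) → TruthRelation n → Set₁
IsIntersectiveMixed 𝟙 𝟘 ⊨ =
  ∃[ L ] Represents {𝟙 = 𝟙} {𝟘 = 𝟘} L ⊨

IsMinimalRepresentation : List (MixedRelation {n} 𝟙 𝟘) → TruthRelation n → Set₁
IsMinimalRepresentation {𝟙 = 𝟙} {𝟘 = 𝟘} L ⊨ =
  Represents L ⊨ ×
  (∀ (L′ : List (MixedRelation 𝟙 𝟘)) → Represents L′ ⊨ → length L ≤ length L′)

-- Conn k is the type of k-ary connectives.

data Formula (Atom : Set) (Conn : ℕ → Set) : Set where
  atom : Atom → Formula Atom Conn
  app  : ∀ {k} → Conn k → Vec (Formula Atom Conn) k → Formula Atom Conn

module _ {Atom : Set} {Conn : ℕ → Set}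
         (interp : ∀ {k} → Conn k → Vec (Fin n) k → Fin n)
         (v : Atom → Fin n) where

  eval  : Formula Atom Conn → Fin n
  evals : ∀ {k} → Vec (Formula Atom Conn) k → Vec (Fin n) k

  eval (atom p)   = v p
  eval (app c As) = interp c (evals As)

  evals []       = []
  evals (A ∷ As) = eval A ∷ evals As

-- In realized, k = 0 is allowed; it says that there is at least one valuation.

record Semantics (n : ℕ) : Set₁ where
  field
    Atom      : Set
    Conn      : ℕ → Set
    interp    : ∀ {k} → Conn k → Vec (Fin n) k → Fin n
    Valuation : Pred (Atom → Fin n) 0ℓ
    realized  : ∀ {k} (p : Fin k → Atom) → Injective _≡_ _≡_ p →
                (x : Fin k → Fin n) →
                ∃[ v ] (v ∈ₚ Valuation × (∀ i → v (p i) ≡ x i))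

  Form : Set
  Form = Formula Atom Conn

  ⟦_⟧ : Form → (Atom → Fin n) → Fin n
  ⟦ A ⟧ v = eval interp v A

  valuesOf : (Atom → Fin n) → Pred Form 0ℓ → Pred (Fin n) 0ℓ
  valuesOf v Γ x = ∃[ A ] (A ∈ₚ Γ × ⟦ A ⟧ v ≡ x)

ConstantExpressive : Semantics n → Set
ConstantExpressive S = ∀ x → ∃[ A ] (∀ v → v ∈ₚ Valuation → ⟦ A ⟧ v ≡ x)
  where open Semantics S

Consequence : (S : Semantics n) → TruthRelation n → Rel (Pred (Semantics.Form S) 0ℓ) 0ℓ
Consequence S _⊨_ Γ Δ = ∀ v → v ∈ₚ Valuation → valuesOf v Γ ⊨ valuesOf v Δ
  where open Semantics S

IsGConditional : (S : Semantics n) → TruthRelation n → Semantics.Conn S 2 → Set₁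
IsGConditional S ⊨ c = ∀ (Γ Δ : Pred Form 0ℓ) (A B : Form) →
    ((Γ ⊢ (｛ A ⇒ B ｝ ∪ Δ)) ⇔ ((Γ ∪ ｛ A ｝) ⊢ (｛ B ｝ ∪ Δ)))
  × (((Γ ∪ ｛ A ⇒ B ｝) ⊢ Δ) ⇔ ((Γ ⊢ (｛ A ｝ ∪ Δ)) × ((Γ ∪ ｛ B ｝) ⊢ Δ)))
  where
  open Semantics S
  _⊢_ : Rel (Pred Form 0ℓ) 0ℓ
  _⊢_ = Consequence S ⊨
  _⇒_ : Form → Form → Form
  A ⇒ B = app c (A ∷ B ∷ [])

data ExtendedConn (Conn : ℕ → Set) : ℕ → Set where
  old : ∀ {k} → Conn k → ExtendedConn Conn k
  new : ExtendedConn Conn 2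

-- The language enriched with one binary connective of truth function f; the
-- valuations of the atoms are unchanged.

extend : Semantics n → (Fin n → Fin n → Fin n) → Semantics n
extend {n} S f = record
  { Atom      = Atom
  ; Conn      = ExtendedConn Conn
  ; interp    = interp′
  ; Valuation = Valuation
  ; realized  = realized
  }
  where
  open Semantics S
  interp′ : ∀ {k} → ExtendedConn Conn k → Vec (Fin n) k → Fin n
  interp′ (old c) xs           = interp c xs
  interp′ new     (x ∷ y ∷ []) = f x y

AdmitsGConditional : Semantics n → TruthRelation n → Set₁
AdmitsGConditional S ⊨ = ∃[ f ] IsGConditional (extend S f) ⊨ new

designatedSets : List (MixedRelation {n} 𝟙 𝟘) → List (Subset n)
designatedSets = concatMap (λ M → Dp M ∷ Dc M ∷ [])

-- The same set may occur several times in the list; "other" and "distinct"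
-- refer to the sets themselves, not to their positions.

DC1 : List (Subset n) → Set
DC1 Ds = ∀ {D} → D ∈ₗ Ds →
    (∃[ x ] (x ∈ D × (∀ {E} → E ∈ₗ Ds → E ≢ D → x ∉ E)))
  ⊎ (∃[ E ] (E ∈ₗ Ds × E ≢ D × D ⊆ E))

DC2 : List (Subset n) → Set
DC2 Ds = ∀ Ds′ → Ds′ ⊑ Ds → Ds′ ≢ [] →
  ∃[ x ] (∀ {D} → D ∈ₗ Ds → (x ∈ D) ⇔ Any (λ D′ → D′ ⊆ D) Ds′)

N1 : List (MixedRelation {n} 𝟙 𝟘) → Set
N1 L = ∀ i j → i ≢ j →
    ¬ (Dp (lookup L i) ⊆ Dp (lookup L j))
  × ¬ (Dc (lookup L i) ⊆ Dc (lookup L j))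

N2 : List (MixedRelation {n} 𝟙 𝟘) → Set
N2 L = ∀ i j →
    (Dp (lookup L i) ⊆ Dc (lookup L j) → Dp (lookup L j) ⊆ Dc (lookup L i))
  × (Dc (lookup L j) ⊆ Dp (lookup L i) → Dc (lookup L i) ⊆ Dp (lookup L j))

{-# OPTIONS --safe #-}

-- The pairs (γ , δ) refuting a mixed relation form the down-set of the box (Dp , ∁ Dc), so
-- minimal representations are exactly those whose boxes form an antichain.  Testing a
-- G-conditional on each box then shows that it is a truth function f with
--   f a b ∈ Dc ⇔ (a ∈ Dp → b ∈ Dc)   and   f a b ∈ Dp ⇔ (a ∈ Dc → b ∈ Dp)
-- for every relation of the representation.  Given such f, a ↦ f a 𝟘 contraposes inclusions
-- (N1, N2) and f defines a meet and a join, by which generators of principal filters are built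
-- (DC1, DC2).  Conversely N1 and N2 make the family of designated sets in which f a b has to
-- lie closed upwards, so that DC2 provides the value f a b.

module Submission where

open import Defs
open import Data.Bool.Properties using () renaming (_≟_ to _≟ᵇ_)
open import Data.Fin using (Fin; zero; suc; _≟_)
open import Data.Fin.Properties using (any?; injective⇒≤)
open import Data.Fin.Subset using (Subset; _∈_; _∉_; _⊆_; ∁)
open import Data.Fin.Subset.Properties
  using (_∈?_; _⊆?_; ⊆-refl; x∉p⇒x∈∁p; x∈∁p⇒x∉p)
open import Data.List using (List; []; _∷_; length; lookup; removeAt; filter; foldr; allFin)
open import Data.List.Membership.Propositional using (find; lose) renaming (_∈_ to _∈ₗ_)
open import Data.List.Membership.Propositional.Properties
  using (∈-lookup; ∈-filter⁺; ∈-filter⁻; ∈-allFin)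
open import Data.List.Properties using (length-removeAt′)
open import Data.List.Relation.Binary.Sublist.Propositional using () renaming (_⊆_ to _⊑_)
open import Data.List.Relation.Binary.Sublist.Propositional.Properties using (filter-⊆)
open import Data.List.Relation.Unary.All as All using (All; []; _∷_)
open import Data.List.Relation.Unary.All.Properties using (all-filter)
open import Data.List.Relation.Unary.Any as Any using (Any; here; there)
open import Data.List.Relation.Unary.Any.Properties using (lookup-index)
open import Data.Nat using (ℕ; _<_)
open import Data.Nat.Induction using (<-wellFounded)
open import Data.Nat.Properties using (≤-reflexive; ≤⇒≯)
open import Data.Product using (_×_; _,_; proj₁; proj₂; ∃-syntax)
open import Data.Product.Function.NonDependent.Propositional using (_×-⇔_)
open import Data.Sum using (_⊎_; inj₁; inj₂; [_,_])
open import Data.Vec using (Vec; []; _∷_)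
open import Data.Vec.Properties using (≡-dec)
open import Function using (_∘_; id; case_of_)
open import Function.Bundles using (_⇔_; mk⇔; module Equivalence)
open import Function.Construct.Composition using () renaming (_⇔-∘_ to infixr 5 _⇔-∘_)
open import Function.Construct.Symmetry using (⇔-sym)
open import Function.Related.TypeIsomorphisms using (¬-cong-⇔)
open import Induction.WellFounded using (Acc; acc)
open import Level using (0ℓ)
open import Relation.Binary.PropositionalEquality using (_≡_; _≢_; refl; sym; trans; cong; cong₂; subst)
open import Relation.Nullary using (¬_; Dec; yes; no; contradiction)
open import Relation.Nullary.Decidable using (¬?; _×-dec_; _⊎-dec_; _→-dec_; decidable-stable)
open import Relation.Unary using (Pred; ｛_｝; _∪_; _∩_; Empty; _≐_)
  renaming (_∈_ to _∈ₚ_; _⊆_ to _⊆ₚ_)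

open Equivalence using (to; from)

private
  variable
    n   : ℕ
    𝟙 𝟘 : Fin n

-- Refuted pairs, boxes and the order between mixed relations.

infix 4 _≼_

-- Inclusion of the boxes `(Dp , ∁ Dc)`, whence the reversed second component. In an intersection
-- the smaller relation is redundant beside the larger.
_≼_ : MixedRelation {n} 𝟙 𝟘 → MixedRelation 𝟙 𝟘 → Set
M ≼ N = Dp M ⊆ Dp N × Dc N ⊆ Dc M

≼-trans : ∀ (M N O : MixedRelation {n} 𝟙 𝟘) → M ≼ N → N ≼ O → M ≼ O
≼-trans M N O (p , c) (p′ , c′) = p′ ∘ p , c ∘ c′

_≼?_ : (M N : MixedRelation {n} 𝟙 𝟘) → Dec (M ≼ N)
M ≼? N = (Dp M ⊆? Dp N) ×-dec (Dc N ⊆? Dc M)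

Antichain : List (MixedRelation {n} 𝟙 𝟘) → Set
Antichain L = ∀ i j → lookup L i ≼ lookup L j → i ≡ j

Refutes : MixedRelation {n} 𝟙 𝟘 → Pred (Fin n) 0ℓ → Pred (Fin n) 0ℓ → Set
Refutes M γ δ = γ ⊆ₚ ⟪ Dp M ⟫ × Empty (δ ∩ ⟪ Dc M ⟫)

refutes-anti : ∀ (M : MixedRelation {n} 𝟙 𝟘) {γ γ′ δ δ′} → γ ⊆ₚ γ′ → δ ⊆ₚ δ′ →
  Refutes M γ′ δ′ → Refutes M γ δ
refutes-anti M γ⊆ δ⊆ (p , c) = p ∘ γ⊆ , λ x (x∈δ , x∈C) → c x (δ⊆ x∈δ , x∈C)

refutes-mono : ∀ (M N : MixedRelation {n} 𝟙 𝟘) → M ≼ N → ∀ {γ δ} →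
  Refutes M γ δ → Refutes N γ δ
refutes-mono M N (P⊆ , C⊆) (p , c) = P⊆ ∘ p , λ x (x∈δ , x∈C) → c x (x∈δ , C⊆ x∈C)

refutes-box : ∀ (M : MixedRelation {n} 𝟙 𝟘) → Refutes M ⟪ Dp M ⟫ ⟪ ∁ (Dc M) ⟫
refutes-box M = id , λ x (x∈∁C , x∈C) → x∈∁p⇒x∉p x∈∁C x∈C

-- The box is the greatest pair refuted by `M`, so this single pair recovers the order; decidable
-- membership removes the double negation.
refutes-box⇒≼ : ∀ (M N : MixedRelation {n} 𝟙 𝟘) →
  Refutes N ⟪ Dp M ⟫ ⟪ ∁ (Dc M) ⟫ → M ≼ N
refutes-box⇒≼ M N (p , c) =
  p , λ {x} x∈C → decidable-stable (x ∈? Dc M) (λ x∉ → c x (x∉p⇒x∈∁p x∉ , x∈C))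

mixedHolds⇔irrefutable : ∀ (M : MixedRelation {n} 𝟙 𝟘) {γ δ} →
  MixedHolds M γ δ ⇔ (¬ Refutes M γ δ)
mixedHolds⇔irrefutable M = mk⇔ (λ h (p , c) → h p c) (λ h p c → h (p , c))

module _ {L : List (MixedRelation {n} 𝟙 𝟘)} {_⊨_ : TruthRelation n} (rep : Represents L _⊨_) where

  ⊨⇔irrefutable : ∀ {γ δ} → (γ ⊨ δ) ⇔ (∀ i → ¬ Refutes (lookup L i) γ δ)
  ⊨⇔irrefutable {γ} {δ} = mk⇔
    (λ γ⊨δ i → to (mixedHolds⇔irrefutable (lookup L i)) (All.lookup (to (rep γ δ) γ⊨δ) (∈-lookup i)))
    (λ h → from (rep γ δ) (All.tabulate λ M∈L →
      subst (λ M → MixedHolds M γ δ) (sym (lookup-index M∈L))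
        (from (mixedHolds⇔irrefutable (lookup L (Any.index M∈L))) (h (Any.index M∈L)))))

  ⊨-mono : ∀ {γ γ′ δ δ′} → γ ⊆ₚ γ′ → δ ⊆ₚ δ′ → γ ⊨ δ → γ′ ⊨ δ′
  ⊨-mono γ⊆ δ⊆ γ⊨δ = from ⊨⇔irrefutable λ i →
    to ⊨⇔irrefutable γ⊨δ i ∘ refutes-anti (lookup L i) γ⊆ δ⊆

  ⊨-resp-≐ : ∀ {γ γ′ δ δ′} → γ ≐ γ′ → δ ≐ δ′ → (γ ⊨ δ) ⇔ (γ′ ⊨ δ′)
  ⊨-resp-≐ (γ⊆ , γ⊇) (δ⊆ , δ⊇) = mk⇔ (⊨-mono γ⊆ δ⊆) (⊨-mono γ⊇ δ⊇)

  -- A relation refuting a pair above the box of `k` also refutes that box, hence dominates relation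
  -- `k` and, in an antichain, is relation `k`.
  antichain⇒⊨⇔irrefutableAt : Antichain L → ∀ k {γ δ} →
    ⟪ Dp (lookup L k) ⟫ ⊆ₚ γ → ⟪ ∁ (Dc (lookup L k)) ⟫ ⊆ₚ δ →
    (γ ⊨ δ) ⇔ (¬ Refutes (lookup L k) γ δ)
  antichain⇒⊨⇔irrefutableAt anti k {γ} {δ} P⊆γ C⊆δ = mk⇔
    (λ γ⊨δ → to ⊨⇔irrefutable γ⊨δ k)
    (λ h → from ⊨⇔irrefutable λ i r →
      h (subst (λ j → Refutes (lookup L j) γ δ)
           (sym (anti k i (refutes-box⇒≼ (lookup L k) (lookup L i)
             (refutes-anti (lookup L i) P⊆γ C⊆δ r)))) r))

-- Minimal representations as antichains.

All-removeAt⁺ : ∀ {A : Set} {P : Pred A 0ℓ} (xs : List A) i → All P xs → All P (removeAt xs i)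
All-removeAt⁺ (x ∷ xs) zero    (p ∷ ps) = ps
All-removeAt⁺ (x ∷ xs) (suc i) (p ∷ ps) = p ∷ All-removeAt⁺ xs i ps

All-removeAt⁻ : ∀ {A : Set} {P : Pred A 0ℓ} (xs : List A) i →
  P (lookup xs i) → All P (removeAt xs i) → All P xs
All-removeAt⁻ (x ∷ xs) zero    p ps       = p ∷ ps
All-removeAt⁻ (x ∷ xs) (suc i) p (q ∷ ps) = q ∷ All-removeAt⁻ xs i p ps

All-removeAt-lookup : ∀ {A : Set} {P : Pred A 0ℓ} (xs : List A) i j → i ≢ j →
  All P (removeAt xs i) → P (lookup xs j)
All-removeAt-lookup (x ∷ xs) zero    zero    i≢j ps       = contradiction refl i≢j
All-removeAt-lookup (x ∷ xs) zero    (suc j) i≢j ps       = All.lookup ps (∈-lookup j)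
All-removeAt-lookup (x ∷ xs) (suc i) zero    i≢j (p ∷ ps) = p
All-removeAt-lookup (x ∷ xs) (suc i) (suc j) i≢j (p ∷ ps) =
  All-removeAt-lookup xs i j (i≢j ∘ cong suc) ps

-- Whatever relation `i` refutes, relation `j` refutes too, and `j` survives the removal.
represents-removeAt : {L : List (MixedRelation {n} 𝟙 𝟘)} {⊨ : TruthRelation n} →
  Represents L ⊨ → ∀ i j → i ≢ j → lookup L i ≼ lookup L j → Represents (removeAt L i) ⊨
represents-removeAt {L = L} rep i j i≢j Mᵢ≼Mⱼ γ δ = mk⇔ (All-removeAt⁺ L i) restore ⇔-∘ rep γ δ
  where
  restore : All (λ M → MixedHolds M γ δ) (removeAt L i) → All (λ M → MixedHolds M γ δ) L
  restore ps = All-removeAt⁻ L i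
    (from (mixedHolds⇔irrefutable (lookup L i))
      (to (mixedHolds⇔irrefutable (lookup L j)) (All-removeAt-lookup L i j i≢j ps)
        ∘ refutes-mono (lookup L i) (lookup L j) Mᵢ≼Mⱼ))
    ps

length-removeAt< : ∀ {A : Set} (xs : List A) i → length (removeAt xs i) < length xs
length-removeAt< xs i = ≤-reflexive (sym (length-removeAt′ xs i))

minimal⇒antichain : {L : List (MixedRelation {n} 𝟙 𝟘)} {⊨ : TruthRelation n} →
  IsMinimalRepresentation L ⊨ → Antichain L
minimal⇒antichain {L = L} (rep , min) i j Mᵢ≼Mⱼ = decidable-stable (i ≟ j) λ i≢j →
  ≤⇒≯ (min (removeAt L i) (represents-removeAt rep i j i≢j Mᵢ≼Mⱼ)) (length-removeAt< L i)

-- The box of relation `i` is rejected by `⊨`, so some relation of the other list must refute it.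
-- Finite search extracts that relation constructively.
represents⇒dominated : {L L′ : List (MixedRelation {n} 𝟙 𝟘)} {⊨ : TruthRelation n} →
  Represents L ⊨ → Represents L′ ⊨ → ∀ i → ∃[ j ] lookup L i ≼ lookup L′ j
represents⇒dominated {L = L} {L′} rep rep′ i =
  decidable-stable (any? λ j → lookup L i ≼? lookup L′ j) λ none →
    to (⊨⇔irrefutable rep)
      (from (⊨⇔irrefutable rep′) (λ j r → none (j , refutes-box⇒≼ (lookup L i) (lookup L′ j) r)))
      i (refutes-box (lookup L i))

antichain⇒minimal : {L : List (MixedRelation {n} 𝟙 𝟘)} {⊨ : TruthRelation n} →
  Represents L ⊨ → Antichain L → IsMinimalRepresentation L ⊨
antichain⇒minimal {L = L} rep anti = rep , λ L′ rep′ →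
  let above  = represents⇒dominated rep rep′
      above′ = represents⇒dominated rep′ rep
      -- Going up to `L′` and back ends above the starting relation, hence at it by `anti`. The
      -- index map of `above` thus has a left inverse and is injective.
      round : ∀ i j → proj₁ (above i) ≡ j → i ≡ proj₁ (above′ j)
      round i j eq = anti i _ (≼-trans (lookup L i) (lookup L′ j) (lookup L (proj₁ (above′ j)))
        (subst (λ j → lookup L i ≼ lookup L′ j) eq (proj₂ (above i))) (proj₂ (above′ j)))
  in injective⇒≤ {f = proj₁ ∘ above} λ {i} {i′} eq →
       trans (round i _ eq) (sym (round i′ _ refl))

-- Redundant relations are dropped one at a time; `removeAt` is no structural descent, so the
-- recursion is on the length.
intersectiveMixed⇒antichain : {⊨ : TruthRelation n} → IsIntersectiveMixed 𝟙 𝟘 ⊨ →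
  ∃[ L ] (Represents {𝟙 = 𝟙} {𝟘 = 𝟘} L ⊨ × Antichain L)
intersectiveMixed⇒antichain {n} {𝟙} {𝟘} {⊨} (L₀ , rep₀) = go L₀ rep₀ (<-wellFounded (length L₀))
  where
  go : ∀ L → Represents L ⊨ → Acc _<_ (length L) →
    ∃[ L ] (Represents {𝟙 = 𝟙} {𝟘 = 𝟘} L ⊨ × Antichain L)
  go L rep (acc rs)
    with any? (λ i → any? λ j → ¬? (i ≟ j) ×-dec (lookup L i ≼? lookup L j))
  ... | yes (i , j , i≢j , Mᵢ≼Mⱼ) =
          go (removeAt L i) (represents-removeAt rep i j i≢j Mᵢ≼Mⱼ) (rs (length-removeAt< L i))
  ... | no none = L , rep , λ i j Mᵢ≼Mⱼ →
          decidable-stable (i ≟ j) λ i≢j → none (i , j , i≢j , Mᵢ≼Mⱼ)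

-- The conditional rules on truth values, and their reduction to single relations.

IsTruthConditional : TruthRelation n → (Fin n → Fin n → Fin n) → Set₁
IsTruthConditional _⊨_ f = ∀ γ δ a b →
    ((γ ⊨ (｛ f a b ｝ ∪ δ)) ⇔ ((γ ∪ ｛ a ｝) ⊨ (｛ b ｝ ∪ δ)))
  × (((γ ∪ ｛ f a b ｝) ⊨ δ) ⇔ ((γ ⊨ (｛ a ｝ ∪ δ)) × ((γ ∪ ｛ b ｝) ⊨ δ)))

Implication : (Fin n → Fin n → Fin n) → Subset n → Subset n → Set
Implication f D E = ∀ a b → (f a b ∈ E) ⇔ (a ∈ D → b ∈ E)

-- `Dp` and `Dc` cross over because a conditional on the right sends its antecedent to the premises,
-- governed by `Dp`, and one on the left sends it to the conclusions, governed by `Dc`.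
IsLocalConditional : (Fin n → Fin n → Fin n) → MixedRelation {n} 𝟙 𝟘 → Set
IsLocalConditional f M = Implication f (Dp M) (Dc M) × Implication f (Dc M) (Dp M)

refutes-∪ˡ : ∀ (M : MixedRelation {n} 𝟙 𝟘) {γ δ x} →
  Refutes M (γ ∪ ｛ x ｝) δ ⇔ (x ∈ Dp M × Refutes M γ δ)
refutes-∪ˡ M = mk⇔
  (λ (p , c) → p (inj₂ refl) , p ∘ inj₁ , c)
  (λ (x∈P , p , c) → [ p , (λ { refl → x∈P }) ] , c)

refutes-∪ʳ : ∀ (M : MixedRelation {n} 𝟙 𝟘) {γ δ x} →
  Refutes M γ (｛ x ｝ ∪ δ) ⇔ (x ∉ Dc M × Refutes M γ δ)
refutes-∪ʳ M = mk⇔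
  (λ (p , c) → (λ x∈C → c _ (inj₁ refl , x∈C)) , p , λ y (y∈δ , y∈C) → c y (inj₂ y∈δ , y∈C))
  (λ (x∉C , p , c) → p , λ { y (inj₁ refl , y∈C) → x∉C y∈C ; y (inj₂ y∈δ , y∈C) → c y (y∈δ , y∈C) })

refutes-∪ˡʳ : ∀ (M : MixedRelation {n} 𝟙 𝟘) {γ δ x y} →
  Refutes M (γ ∪ ｛ x ｝) (｛ y ｝ ∪ δ) ⇔ ((x ∈ Dp M × y ∉ Dc M) × Refutes M γ δ)
refutes-∪ˡʳ M = mk⇔
  (λ r → let x∈P , r′ = to (refutes-∪ˡ M) r
             y∉C , r″ = to (refutes-∪ʳ M) r′ in (x∈P , y∉C) , r″)
  (λ ((x∈P , y∉C) , r) → from (refutes-∪ˡ M) (x∈P , from (refutes-∪ʳ M) (y∉C , r)))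

module _ {f : Fin n → Fin n → Fin n} {D E : Subset n} where

  implication⇒∉ : Implication f D E → ∀ a b → (f a b ∉ E) ⇔ (a ∈ D × b ∉ E)
  implication⇒∉ imp a b = mk⇔
    (λ ∉E → decidable-stable (a ∈? D) (λ a∉D → ∉E (from (imp a b) λ a∈D → contradiction a∈D a∉D))
          , λ b∈E → ∉E (from (imp a b) λ _ → b∈E))
    (λ (a∈D , b∉E) ∈E → b∉E (to (imp a b) ∈E a∈D))

  implication⇒∈ : Implication f D E → ∀ a b → (f a b ∈ E) ⇔ (a ∉ D ⊎ b ∈ E)
  implication⇒∈ imp a b = mk⇔
    (λ ∈E → case a ∈? D of λ { (yes a∈D) → inj₂ (to (imp a b) ∈E a∈D) ; (no a∉D) → inj₁ a∉D })
    (λ h → from (imp a b) λ a∈D → [ contradiction a∈D , id ] h)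

  -- Sequents only express the absence of refutations, so the rules yield negated statements;
  -- decidable membership makes them positive, here and in `∈⇒implication`.
  ∉⇒implication : (∀ a b → (¬ f a b ∉ E) ⇔ (¬ (a ∈ D × b ∉ E))) → Implication f D E
  ∉⇒implication h a b = mk⇔
    (λ ∈E a∈D → decidable-stable (b ∈? E) λ b∉E → to (h a b) (contradiction ∈E) (a∈D , b∉E))
    (λ imp → decidable-stable (f a b ∈? E) (from (h a b) λ (a∈D , b∉E) → b∉E (imp a∈D)))

  ∈⇒implication : (∀ a b → (f a b ∉ E) ⇔ ((¬ a ∉ D) × b ∉ E)) → Implication f D E
  ∈⇒implication h a b = mk⇔
    (λ ∈E a∈D → decidable-stable (b ∈? E) λ b∉E → from (h a b) (contradiction a∈D , b∉E) ∈E)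
    (λ imp → decidable-stable (f a b ∈? E) λ ∉E →
      let ¬a∉D , b∉E = to (h a b) ∉E in ¬a∉D (b∉E ∘ imp))

-- Serves to strip the factor `Refutes M γ δ` when `γ`, `δ` form the box of `M`, where this factor
-- holds.
¬×-inhabited : ∀ {A B C : Set} → C ⇔ (A × B) → B → (¬ A) ⇔ (¬ C)
¬×-inhabited e b = mk⇔ (λ ¬a → ¬a ∘ proj₁ ∘ to e) (λ ¬c a → ¬c (from e (a , b)))

¬⊎×⇔ : ∀ {A B C : Set} → (¬ ((A ⊎ B) × C)) ⇔ ((¬ (A × C)) × (¬ (B × C)))
¬⊎×⇔ = mk⇔
  (λ h → (λ (a , c) → h (inj₁ a , c)) , (λ (b , c) → h (inj₂ b , c)))
  (λ (h , k) → λ { (inj₁ a , c) → h (a , c) ; (inj₂ b , c) → k (b , c) })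

×-congˡ-⇔ : ∀ {A B C : Set} → A ⇔ B → (A × C) ⇔ (B × C)
×-congˡ-⇔ e = e ×-⇔ mk⇔ id id

module _ {L : List (MixedRelation {n} 𝟙 𝟘)} {_⊨_ : TruthRelation n} (rep : Represents L _⊨_)
         {f : Fin n → Fin n → Fin n} where

  -- A relation refutes the left-hand side of a rule exactly when it refutes some sequent on the
  -- right-hand side, so both rules hold relation by relation.
  local⇒truthConditional : (∀ i → IsLocalConditional f (lookup L i)) → IsTruthConditional _⊨_ f
  local⇒truthConditional local γ δ a b =
      ⇔-sym (⊨⇔irrefutable rep) ⇔-∘ Π-⇔ right ⇔-∘ ⊨⇔irrefutable rep
    , (⇔-sym (⊨⇔irrefutable rep) ×-⇔ ⇔-sym (⊨⇔irrefutable rep))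
        ⇔-∘ mk⇔ (λ h → (λ i → proj₁ (to (left i) (h i))) , (λ i → proj₂ (to (left i) (h i))))
                 (λ (h , k) i → from (left i) (h i , k i))
        ⇔-∘ ⊨⇔irrefutable rep
    where
    Π-⇔ : ∀ {I : Set} {P Q : I → Set} → (∀ i → P i ⇔ Q i) → (∀ i → P i) ⇔ (∀ i → Q i)
    Π-⇔ e = mk⇔ (λ h i → to (e i) (h i)) (λ h i → from (e i) (h i))

    module _ (i : Fin (length L)) where
      M = lookup L i

      right : (¬ Refutes M γ (｛ f a b ｝ ∪ δ)) ⇔ (¬ Refutes M (γ ∪ ｛ a ｝) (｛ b ｝ ∪ δ))
      right = ¬-cong-⇔ (⇔-sym (refutes-∪ˡʳ M)
        ⇔-∘ ×-congˡ-⇔ (implication⇒∉ (proj₁ (local i)) a b)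
        ⇔-∘ refutes-∪ʳ M)

      left : (¬ Refutes M (γ ∪ ｛ f a b ｝) δ)
           ⇔ ((¬ Refutes M γ (｛ a ｝ ∪ δ)) × (¬ Refutes M (γ ∪ ｛ b ｝) δ))
      left = (¬-cong-⇔ (⇔-sym (refutes-∪ʳ M)) ×-⇔ ¬-cong-⇔ (⇔-sym (refutes-∪ˡ M)))
        ⇔-∘ ¬⊎×⇔
        ⇔-∘ ¬-cong-⇔ (×-congˡ-⇔ (implication⇒∈ (proj₂ (local i)) a b) ⇔-∘ refutes-∪ˡ M)

  -- Both rules are instantiated at the box of relation `i`. All sequents involved extend this box,
  -- so only relation `i` can refute them; what remains are conditions on `a`, `b` and `f a b`.
  truthConditional⇒local : Antichain L → IsTruthConditional _⊨_ f →
    ∀ i → IsLocalConditional f (lookup L i)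
  truthConditional⇒local anti cond i =
      ∉⇒implication (λ a b →
        -- Composition starts from the last factor: a membership becomes a non-refutation, then a
        -- sequent of `⊨`; the rule applies, and the same passage is run backwards.
        ⇔-sym (¬×-inhabited (refutes-∪ˡʳ M) box) ⇔-∘ at inj₁ inj₂
          ⇔-∘ proj₁ (cond γ δ a b)
          ⇔-∘ ⇔-sym (at id inj₂) ⇔-∘ ¬×-inhabited (refutes-∪ʳ M) box)
    , ∈⇒implication (λ a b →
        (⇔-sym (¬×-inhabited (refutes-∪ʳ M) box) ×-⇔ ⇔-sym (¬×-inhabited (refutes-∪ˡ M) box))
          ⇔-∘ (at id inj₂ ×-⇔ at inj₁ id)
          ⇔-∘ proj₂ (cond γ δ a b)
          ⇔-∘ ⇔-sym (at inj₁ id) ⇔-∘ ¬×-inhabited (refutes-∪ˡ M) box)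
    where
    M = lookup L i
    γ = ⟪ Dp M ⟫
    δ = ⟪ ∁ (Dc M) ⟫
    box = refutes-box M
    at : ∀ {γ′ δ′} → γ ⊆ₚ γ′ → δ ⊆ₚ δ′ → (γ′ ⊨ δ′) ⇔ (¬ Refutes M γ′ δ′)
    at = antichain⇒⊨⇔irrefutableAt rep anti i

-- Passage between formulas and truth values.

module _ (S : Semantics n) (f : Fin n → Fin n → Fin n) where

  private
    module S = Semantics S
    module S⁺ = Semantics (extend S f)

  -- The constants granted by `ConstantExpressive S` live in the original language, whereas the
  -- G-rules concern the enriched one.
  embed  : S.Form → S⁺.Form
  embeds : ∀ {k} → Vec S.Form k → Vec S⁺.Form k

  embed (atom p)   = atom p
  embed (app c As) = app (old c) (embeds As)

  embeds []       = []
  embeds (A ∷ As) = embed A ∷ embeds As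

  eval-embed   : ∀ v A → S⁺.⟦ embed A ⟧ v ≡ S.⟦ A ⟧ v
  evals-embeds : ∀ v {k} (As : Vec S.Form k) →
    evals S⁺.interp v (embeds As) ≡ evals S.interp v As

  eval-embed v (atom p)   = refl
  eval-embed v (app c As) = cong (S.interp c) (evals-embeds v As)

  evals-embeds v []       = refl
  evals-embeds v (A ∷ As) = cong₂ _∷_ (eval-embed v A) (evals-embeds v As)

  valuesOf-∪ˡ : ∀ {v Γ A a} {γ : Pred (Fin n) 0ℓ} → S⁺.valuesOf v Γ ≐ γ → S⁺.⟦ A ⟧ v ≡ a →
    S⁺.valuesOf v (Γ ∪ ｛ A ｝) ≐ (γ ∪ ｛ a ｝)
  valuesOf-∪ˡ {A = A} (⊆ , ⊇) refl =
      (λ { (B , inj₁ B∈Γ , eq) → inj₁ (⊆ (B , B∈Γ , eq)) ; (B , inj₂ refl , eq) → inj₂ eq })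
    , (λ { (inj₁ x∈γ) → let B , B∈Γ , eq = ⊇ x∈γ in B , inj₁ B∈Γ , eq ; (inj₂ eq) → A , inj₂ refl , eq })

  valuesOf-∪ʳ : ∀ {v Γ A a} {γ : Pred (Fin n) 0ℓ} → S⁺.⟦ A ⟧ v ≡ a → S⁺.valuesOf v Γ ≐ γ →
    S⁺.valuesOf v (｛ A ｝ ∪ Γ) ≐ (｛ a ｝ ∪ γ)
  valuesOf-∪ʳ {A = A} refl (⊆ , ⊇) =
      (λ { (B , inj₂ B∈Γ , eq) → inj₂ (⊆ (B , B∈Γ , eq)) ; (B , inj₁ refl , eq) → inj₁ eq })
    , (λ { (inj₂ x∈γ) → let B , B∈Γ , eq = ⊇ x∈γ in B , inj₂ B∈Γ , eq ; (inj₁ eq) → A , inj₁ refl , eq })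

  module _ {L : List (MixedRelation {n} 𝟙 𝟘)} {_⊨_ : TruthRelation n} (rep : Represents L _⊨_) where

    private
      _⊢_ = Consequence (extend S f) _⊨_
      ≐-refl : ∀ {A : Set} {P : Pred A 0ℓ} → P ≐ P
      ≐-refl = id , id

    -- At each valuation separately, the rules on values are applied to the values taken by the
    -- formulas.
    truthConditional⇒G : IsTruthConditional _⊨_ f → IsGConditional (extend S f) _⊨_ new
    truthConditional⇒G cond Γ Δ A B =
        mk⇔ (λ h v v∈ → to (right v) (h v v∈)) (λ h v v∈ → from (right v) (h v v∈))
      , mk⇔ (λ h → (λ v v∈ → proj₁ (to (left v) (h v v∈))) , (λ v v∈ → proj₂ (to (left v) (h v v∈))))
            (λ (h , k) v v∈ → from (left v) (h v v∈ , k v v∈))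
      where
      module _ (v : S.Atom → Fin n) where
        ⟦_⟧ᵥ = S⁺.valuesOf v
        A⇒B : S⁺.Form
        A⇒B = app new (A ∷ B ∷ [])

        right : (⟦ Γ ⟧ᵥ ⊨ ⟦ ｛ A⇒B ｝ ∪ Δ ⟧ᵥ) ⇔ (⟦ Γ ∪ ｛ A ｝ ⟧ᵥ ⊨ ⟦ ｛ B ｝ ∪ Δ ⟧ᵥ)
        right = ⇔-sym (⊨-resp-≐ rep (valuesOf-∪ˡ ≐-refl refl) (valuesOf-∪ʳ refl ≐-refl))
          ⇔-∘ proj₁ (cond ⟦ Γ ⟧ᵥ ⟦ Δ ⟧ᵥ (S⁺.⟦ A ⟧ v) (S⁺.⟦ B ⟧ v))
          ⇔-∘ ⊨-resp-≐ rep ≐-refl (valuesOf-∪ʳ refl ≐-refl)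

        left : (⟦ Γ ∪ ｛ A⇒B ｝ ⟧ᵥ ⊨ ⟦ Δ ⟧ᵥ)
             ⇔ ((⟦ Γ ⟧ᵥ ⊨ ⟦ ｛ A ｝ ∪ Δ ⟧ᵥ) × (⟦ Γ ∪ ｛ B ｝ ⟧ᵥ ⊨ ⟦ Δ ⟧ᵥ))
        left = ( ⇔-sym (⊨-resp-≐ rep ≐-refl (valuesOf-∪ʳ refl ≐-refl))
             ×-⇔ ⇔-sym (⊨-resp-≐ rep (valuesOf-∪ˡ ≐-refl refl) ≐-refl))
          ⇔-∘ proj₂ (cond ⟦ Γ ⟧ᵥ ⟦ Δ ⟧ᵥ (S⁺.⟦ A ⟧ v) (S⁺.⟦ B ⟧ v))
          ⇔-∘ ⊨-resp-≐ rep (valuesOf-∪ˡ ≐-refl refl) ≐-refl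

    module _ (const : ConstantExpressive S) where

      constant : Fin n → S⁺.Form
      constant x = embed (proj₁ (const x))

      constants : Pred (Fin n) 0ℓ → Pred S⁺.Form 0ℓ
      constants γ A = ∃[ x ] (x ∈ₚ γ × constant x ≡ A)

      eval-constant : ∀ {v} → v ∈ₚ S.Valuation → ∀ x → S⁺.⟦ constant x ⟧ v ≡ x
      eval-constant {v} v∈ x = trans (eval-embed v (proj₁ (const x))) (proj₂ (const x) v v∈)

      valuesOf-constants : ∀ {v} → v ∈ₚ S.Valuation → ∀ γ → S⁺.valuesOf v (constants γ) ≐ γ
      valuesOf-constants v∈ γ =
          (λ { (_ , (x , x∈γ , refl) , refl) → subst γ (sym (eval-constant v∈ x)) x∈γ })
        , (λ {x} x∈γ → constant x , (x , x∈γ , refl) , eval-constant v∈ x)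

      -- The two sets of values are the same at every valuation, so a single one decides the
      -- consequence; the case `k = 0` of `realized` supplies it.
      ⊢⇔⊨ : ∀ {Γ Δ γ δ} → (∀ {v} → v ∈ₚ S.Valuation → S⁺.valuesOf v Γ ≐ γ) →
        (∀ {v} → v ∈ₚ S.Valuation → S⁺.valuesOf v Δ ≐ δ) → (Γ ⊢ Δ) ⇔ (γ ⊨ δ)
      ⊢⇔⊨ Γ≐γ Δ≐δ = mk⇔
        (λ h → let v , v∈ , _ = S.realized {0} (λ ()) (λ { {()} }) (λ ())
               in to (⊨-resp-≐ rep (Γ≐γ v∈) (Δ≐δ v∈)) (h v v∈))
        (λ h v v∈ → from (⊨-resp-≐ rep (Γ≐γ v∈) (Δ≐δ v∈)) h)

      -- Constant formulas realise arbitrary `γ`, `δ`, `a`, `b` uniformly in the valuation, and the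
      -- G-rules are applied to them.
      G⇒truthConditional : IsGConditional (extend S f) _⊨_ new → IsTruthConditional _⊨_ f
      G⇒truthConditional G γ δ a b =
          ⊢⇔⊨ (λ v∈ → valuesOf-∪ˡ (Γ≐γ v∈) (A≡a v∈)) (λ v∈ → valuesOf-∪ʳ (B≡b v∈) (Δ≐δ v∈))
            ⇔-∘ proj₁ (G Γ Δ A B)
            ⇔-∘ ⇔-sym (⊢⇔⊨ Γ≐γ (λ v∈ → valuesOf-∪ʳ (A⇒B≡fab v∈) (Δ≐δ v∈)))
        , (⊢⇔⊨ Γ≐γ (λ v∈ → valuesOf-∪ʳ (A≡a v∈) (Δ≐δ v∈))
             ×-⇔ ⊢⇔⊨ (λ v∈ → valuesOf-∪ˡ (Γ≐γ v∈) (B≡b v∈)) Δ≐δ)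
            ⇔-∘ proj₂ (G Γ Δ A B)
            ⇔-∘ ⇔-sym (⊢⇔⊨ (λ v∈ → valuesOf-∪ˡ (Γ≐γ v∈) (A⇒B≡fab v∈)) Δ≐δ)
        where
        Γ = constants γ
        Δ = constants δ
        A = constant a
        B = constant b
        A⇒B : S⁺.Form
        A⇒B = app new (A ∷ B ∷ [])

        Γ≐γ : ∀ {v} → v ∈ₚ S.Valuation → S⁺.valuesOf v Γ ≐ γ
        Γ≐γ v∈ = valuesOf-constants v∈ γ

        Δ≐δ : ∀ {v} → v ∈ₚ S.Valuation → S⁺.valuesOf v Δ ≐ δ
        Δ≐δ v∈ = valuesOf-constants v∈ δ

        A≡a : ∀ {v} → v ∈ₚ S.Valuation → S⁺.⟦ A ⟧ v ≡ a
        A≡a v∈ = eval-constant v∈ a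

        B≡b : ∀ {v} → v ∈ₚ S.Valuation → S⁺.⟦ B ⟧ v ≡ b
        B≡b v∈ = eval-constant v∈ b

        A⇒B≡fab : ∀ {v} → v ∈ₚ S.Valuation → S⁺.⟦ A⇒B ⟧ v ≡ f a b
        A⇒B≡fab v∈ = cong₂ f (A≡a v∈) (B≡b v∈)

-- From a conditional to the four conditions.

_∈designated_ : Subset n → MixedRelation {n} 𝟙 𝟘 → Set
D ∈designated M = D ≡ Dp M ⊎ D ≡ Dc M

designatedSets⁻ : ∀ (L : List (MixedRelation {n} 𝟙 𝟘)) {D} → D ∈ₗ designatedSets L →
  ∃[ i ] D ∈designated lookup L i
designatedSets⁻ (M ∷ L) (here eq)            = zero , inj₁ eq
designatedSets⁻ (M ∷ L) (there (here eq))    = zero , inj₂ eq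
designatedSets⁻ (M ∷ L) (there (there D∈Ds)) = let i , D∈ = designatedSets⁻ L D∈Ds in suc i , D∈

Dp∈designatedSets : ∀ (L : List (MixedRelation {n} 𝟙 𝟘)) i → Dp (lookup L i) ∈ₗ designatedSets L
Dp∈designatedSets (M ∷ L) zero    = here refl
Dp∈designatedSets (M ∷ L) (suc i) = there (there (Dp∈designatedSets L i))

Dc∈designatedSets : ∀ (L : List (MixedRelation {n} 𝟙 𝟘)) i → Dc (lookup L i) ∈ₗ designatedSets L
Dc∈designatedSets (M ∷ L) zero    = there (here refl)
Dc∈designatedSets (M ∷ L) (suc i) = there (there (Dc∈designatedSets L i))

designated⁻ : ∀ (L : List (MixedRelation {n} 𝟙 𝟘)) {D} → D ∈ₗ designatedSets L →
  𝟙 ∈ D × 𝟘 ∉ D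
designated⁻ L D∈Ds with designatedSets⁻ L D∈Ds
... | i , inj₁ refl = 𝟙∈ (premiseDesignated (lookup L i)) , 𝟘∉ (premiseDesignated (lookup L i))
... | i , inj₂ refl = 𝟙∈ (conclusionDesignated (lookup L i)) , 𝟘∉ (conclusionDesignated (lookup L i))

-- The conditional yields a negation a → 𝟘 exchanging Dp and Dc, and through it a meet and a join
-- for which every designated set is a prime filter.
module LatticeOperations (f : Fin n → Fin n → Fin n) (𝟘 : Fin n) where

  neg : Fin n → Fin n
  neg a = f a 𝟘

  meet join : Fin n → Fin n → Fin n
  meet a b = neg (f a (neg b))
  join a b = f (neg a) b

  ∈-neg : ∀ {D E} → Implication f D E → 𝟘 ∉ E → ∀ a → (neg a ∈ E) ⇔ (a ∉ D)
  ∈-neg imp 𝟘∉E a = mk⇔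
    (λ ∈E a∈D → 𝟘∉E (to (imp a 𝟘) ∈E a∈D))
    (λ a∉D → from (imp a 𝟘) λ a∈D → contradiction a∈D a∉D)

  -- Classically `a ∧ b` is `¬ (a → ¬ b)`. The outer negation moves the test from `E` to `D`, and
  -- the inner conditional moves it back to `E`.
  ∈-meet : ∀ {D E} → Implication f D E → Implication f E D → 𝟘 ∉ D → 𝟘 ∉ E →
    ∀ a b → (meet a b ∈ E) ⇔ (a ∈ E × b ∈ E)
  ∈-meet {D} {E} imp imp′ 𝟘∉D 𝟘∉E a b = mk⇔
    (λ ∈E → let a∈E , ¬∈D = to (implication⇒∉ imp′ a (neg b)) (to (∈-neg imp 𝟘∉E _) ∈E)
            in a∈E , decidable-stable (b ∈? E) (¬∈D ∘ from (∈-neg imp′ 𝟘∉D b)))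
    (λ (a∈E , b∈E) → from (∈-neg imp 𝟘∉E _) (from (implication⇒∉ imp′ a (neg b))
      (a∈E , λ ∈D → to (∈-neg imp′ 𝟘∉D b) ∈D b∈E)))

  ∈-join : ∀ {D E} → Implication f D E → Implication f E D → 𝟘 ∉ D →
    ∀ a b → (join a b ∈ E) ⇔ (a ∈ E ⊎ b ∈ E)
  ∈-join {D} {E} imp imp′ 𝟘∉D a b = mk⇔
    (λ ∈E → [ (λ ¬a → inj₁ (decidable-stable (a ∈? E) (¬a ∘ from (∈-neg imp′ 𝟘∉D a)))) , inj₂ ]
      (to (implication⇒∈ imp (neg a) b) ∈E))
    (λ h → from (implication⇒∈ imp (neg a) b)
      ([ (λ a∈E → inj₁ λ ∈D → to (∈-neg imp′ 𝟘∉D a) ∈D a∈E) , inj₂ ] h))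

  -- Contraposition through `neg`: if `a ∉ D*` then `neg a ∈ D ⊆ E`, so `a ∉ E*`.
  dual-antitone : ∀ {D D* E E*} → Implication f D* D → Implication f E* E → 𝟘 ∉ D → 𝟘 ∉ E →
    D ⊆ E → E* ⊆ D*
  dual-antitone {D* = D*} imp imp′ 𝟘∉D 𝟘∉E D⊆E {a} a∈E* = decidable-stable (a ∈? D*) λ a∉D* →
    to (∈-neg imp′ 𝟘∉E a) (D⊆E (from (∈-neg imp 𝟘∉D a) a∉D*)) a∈E*

module _ (L : List (MixedRelation {n} 𝟙 𝟘)) {f : Fin n → Fin n → Fin n}
         (local : ∀ i → IsLocalConditional f (lookup L i)) where

  open LatticeOperations f 𝟘

  private
    Ds = designatedSets L
    P C : Fin (length L) → Subset n
    P i = Dp (lookup L i)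
    C i = Dc (lookup L i)

    𝟘∉P : ∀ i → 𝟘 ∉ P i
    𝟘∉P i = 𝟘∉ (premiseDesignated (lookup L i))

    𝟘∉C : ∀ i → 𝟘 ∉ C i
    𝟘∉C i = 𝟘∉ (conclusionDesignated (lookup L i))

  designated-meet : ∀ {D} → D ∈ₗ Ds → ∀ a b → (meet a b ∈ D) ⇔ (a ∈ D × b ∈ D)
  designated-meet D∈Ds with designatedSets⁻ L D∈Ds
  ... | i , inj₁ refl = ∈-meet (proj₂ (local i)) (proj₁ (local i)) (𝟘∉C i) (𝟘∉P i)
  ... | i , inj₂ refl = ∈-meet (proj₁ (local i)) (proj₂ (local i)) (𝟘∉P i) (𝟘∉C i)

  designated-join : ∀ {D} → D ∈ₗ Ds → ∀ a b → (join a b ∈ D) ⇔ (a ∈ D ⊎ b ∈ D)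
  designated-join D∈Ds with designatedSets⁻ L D∈Ds
  ... | i , inj₁ refl = ∈-join (proj₂ (local i)) (proj₁ (local i)) (𝟘∉C i)
  ... | i , inj₂ refl = ∈-join (proj₁ (local i)) (proj₂ (local i)) (𝟘∉P i)

  -- The empty meet is `𝟙`, which lies in every designated set; dually, the empty join below is `𝟘`,
  -- which lies in none.
  ⋀ : List (Fin n) → Fin n
  ⋀ = foldr meet 𝟙

  ∈-⋀ : ∀ {D} → D ∈ₗ Ds → ∀ xs → (⋀ xs ∈ D) ⇔ All (_∈ D) xs
  ∈-⋀ D∈Ds []       = mk⇔ (λ _ → []) (λ _ → proj₁ (designated⁻ L D∈Ds))
  ∈-⋀ D∈Ds (x ∷ xs) = mk⇔
    (λ ∈D → let x∈ , xs∈ = to (designated-meet D∈Ds x (⋀ xs)) ∈D in x∈ ∷ to (∈-⋀ D∈Ds xs) xs∈)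
    (λ { (x∈ ∷ xs∈) → from (designated-meet D∈Ds x (⋀ xs)) (x∈ , from (∈-⋀ D∈Ds xs) xs∈) })

  -- The meet of all elements of `D`; when `D` is designated, it generates `D` as a principal
  -- filter.
  generator : Subset n → Fin n
  generator D = ⋀ (filter (_∈? D) (allFin n))

  ∈-generator : ∀ D {E} → E ∈ₗ Ds → (generator D ∈ E) ⇔ (D ⊆ E)
  ∈-generator D E∈Ds = mk⇔
    (λ ∈E {x} x∈D → All.lookup (to (∈-⋀ E∈Ds _) ∈E) (∈-filter⁺ (_∈? D) (∈-allFin x) x∈D))
    (λ D⊆E → from (∈-⋀ E∈Ds _) (All.map (λ x∈D → D⊆E x∈D) (all-filter (_∈? D) (allFin n))))

  ⋁ : List (Subset n) → Fin n
  ⋁ = foldr (join ∘ generator) 𝟘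

  ∈-⋁ : ∀ {E} → E ∈ₗ Ds → ∀ Ds′ → (⋁ Ds′ ∈ E) ⇔ Any (_⊆ E) Ds′
  ∈-⋁ E∈Ds []        = mk⇔ (λ 𝟘∈E → contradiction 𝟘∈E (proj₂ (designated⁻ L E∈Ds))) λ ()
  ∈-⋁ E∈Ds (D ∷ Ds′) = mk⇔
    (λ ∈E → [ here ∘ to (∈-generator D E∈Ds) , there ∘ to (∈-⋁ E∈Ds Ds′) ]
      (to (designated-join E∈Ds (generator D) (⋁ Ds′)) ∈E))
    (λ h → from (designated-join E∈Ds (generator D) (⋁ Ds′)) (case h of λ
      { (here D⊆E) → inj₁ (from (∈-generator D E∈Ds) D⊆E)
      ; (there h′) → inj₂ (from (∈-⋁ E∈Ds Ds′) h′) }))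

  -- Any set of the list containing the generator of `D` includes `D`. If no other set does so, the
  -- generator is the value private to `D`.
  local⇒DC1 : DC1 Ds
  local⇒DC1 {D} D∈Ds with Any.any? (λ E → ¬? (≡-dec _≟ᵇ_ E D) ×-dec (D ⊆? E)) Ds
  ... | yes larger = let E , E∈Ds , E≢D , D⊆E = find larger in inj₂ (E , E∈Ds , E≢D , D⊆E)
  ... | no none    = inj₁ (generator D , from (∈-generator D D∈Ds) ⊆-refl , λ E∈Ds E≢D ∈E →
                       none (lose E∈Ds (E≢D , to (∈-generator D E∈Ds) ∈E)))

  local⇒DC2 : DC2 Ds
  local⇒DC2 Ds′ _ _ = ⋁ Ds′ , λ E∈Ds → ∈-⋁ E∈Ds Ds′

  -- Duality completes either inclusion to a comparison `≼` of the two relations, which the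
  -- antichain excludes.
  local⇒N1 : Antichain L → N1 L
  local⇒N1 anti i j i≢j =
      (λ P⊆ → i≢j (anti i j (P⊆ ,
        dual-antitone (proj₂ (local i)) (proj₂ (local j)) (𝟘∉P i) (𝟘∉P j) P⊆)))
    , (λ C⊆ → i≢j (sym (anti j i
        (dual-antitone (proj₁ (local i)) (proj₁ (local j)) (𝟘∉C i) (𝟘∉C j) C⊆ , C⊆))))

  local⇒N2 : N2 L
  local⇒N2 i j =
      dual-antitone (proj₂ (local i)) (proj₁ (local j)) (𝟘∉P i) (𝟘∉C j)
    , dual-antitone (proj₁ (local j)) (proj₂ (local i)) (𝟘∉C j) (𝟘∉P i)

-- From the conditions to a conditional.

module _ (L : List (MixedRelation {n} 𝟙 𝟘)) (dc2 : DC2 (designatedSets L)) (n1 : N1 L) (n2 : N2 L)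
  where

  private
    Ds = designatedSets L
    P C : Fin (length L) → Subset n
    P i = Dp (lookup L i)
    C i = Dc (lookup L i)

  -- It may happen that no designated set is required to contain the value sought; `𝟘` then serves.
  DC2-with-[] : ∀ Ds′ → Ds′ ⊑ Ds → ∃[ x ] (∀ {D} → D ∈ₗ Ds → (x ∈ D) ⇔ Any (_⊆ D) Ds′)
  DC2-with-[] []           _  = 𝟘 , λ D∈Ds → mk⇔
    (λ 𝟘∈D → contradiction 𝟘∈D (proj₂ (designated⁻ L D∈Ds))) λ ()
  DC2-with-[] Ds′@(_ ∷ _) ⊑Ds = dc2 Ds′ ⊑Ds λ ()

  P⊆P⇒≡ : ∀ {i j} → P i ⊆ P j → i ≡ j
  P⊆P⇒≡ {i} {j} P⊆ = decidable-stable (i ≟ j) λ i≢j → proj₁ (n1 i j i≢j) P⊆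

  C⊆C⇒≡ : ∀ {i j} → C i ⊆ C j → i ≡ j
  C⊆C⇒≡ {i} {j} C⊆ = decidable-stable (i ≟ j) λ i≢j → proj₂ (n1 i j i≢j) C⊆

  module _ (a b : Fin n) where

    -- The designated sets that the value of a → b has to belong to.
    Required : Subset n → Set
    Required D = ∃[ i ] ((D ≡ P i × (a ∈ C i → b ∈ P i)) ⊎ (D ≡ C i × (a ∈ P i → b ∈ C i)))

    required? : ∀ D → Dec (Required D)
    required? D = any? λ i →
      (≡-dec _≟ᵇ_ D (P i) ×-dec ((a ∈? C i) →-dec (b ∈? P i)))
      ⊎-dec (≡-dec _≟ᵇ_ D (C i) ×-dec ((a ∈? P i) →-dec (b ∈? C i)))

    -- Upward closure of the requirements. If `D` is `P j`, N1 forces `j` to be `i`. If `D` is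
    -- `C j`, N2 gives `C i ⊆ P j`, so `a ∈ P j`, whence `b ∈ C j ⊆ P i`.
    required-P : ∀ {D i} → Required D → D ⊆ P i → a ∈ C i → b ∈ P i
    required-P (j , inj₁ (refl , imp)) P⊆P a∈C with refl ← P⊆P⇒≡ P⊆P = imp a∈C
    required-P {i = i} (j , inj₂ (refl , imp)) C⊆P a∈C = C⊆P (imp (proj₂ (n2 i j) C⊆P a∈C))

    required-C : ∀ {D i} → Required D → D ⊆ C i → a ∈ P i → b ∈ C i
    required-C (j , inj₂ (refl , imp)) C⊆C a∈P with refl ← C⊆C⇒≡ C⊆C = imp a∈P
    required-C {i = i} (j , inj₁ (refl , imp)) P⊆C a∈P = P⊆C (imp (proj₁ (n2 j i) P⊆C a∈P))

    required⇒∈ : ∀ {D} → Required D → D ∈ₗ Ds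
    required⇒∈ (i , inj₁ (refl , _)) = Dp∈designatedSets L i
    required⇒∈ (i , inj₂ (refl , _)) = Dc∈designatedSets L i

    realizer : ∃[ x ] (∀ {E} → E ∈ₗ Ds → (x ∈ E) ⇔ Any (_⊆ E) (filter required? Ds))
    realizer = DC2-with-[] (filter required? Ds) (filter-⊆ required? Ds)

    implicationValue : Fin n
    implicationValue = proj₁ realizer

    ∈-implicationValue : ∀ {E} → E ∈ₗ Ds →
      (implicationValue ∈ E) ⇔ (∃[ D ] (Required D × D ⊆ E))
    ∈-implicationValue E∈Ds = mk⇔
      (λ ∈E → let D , D∈ , D⊆E = find (to (proj₂ realizer E∈Ds) ∈E)
              in D , proj₂ (∈-filter⁻ required? {xs = Ds} D∈) , λ {_} → D⊆E)
      (λ (D , req , D⊆E) → from (proj₂ realizer E∈Ds)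
        (lose (∈-filter⁺ required? (required⇒∈ req) req) D⊆E))

  -- The value lies in exactly the sets above some required set; by upward closure such a set
  -- satisfies its own implication, and a required set lies above itself.
  implicationValue-local : ∀ i → IsLocalConditional implicationValue (lookup L i)
  implicationValue-local i =
      (λ a b → mk⇔
        (λ ∈C → let _ , req , D⊆C = to (∈-implicationValue a b (Dc∈designatedSets L i)) ∈C
                in required-C a b req D⊆C)
        (λ imp → from (∈-implicationValue a b (Dc∈designatedSets L i))
          (C i , (i , inj₂ (refl , imp)) , ⊆-refl)))
    , (λ a b → mk⇔
        (λ ∈P → let _ , req , D⊆P = to (∈-implicationValue a b (Dp∈designatedSets L i)) ∈P
                in required-P a b req D⊆P)
        (λ imp → from (∈-implicationValue a b (Dp∈designatedSets L i))
          (P i , (i , inj₁ (refl , imp)) , ⊆-refl)))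

-- Assembling the two directions.

module _ (S : Semantics n) (const : ConstantExpressive S) (⊨ : TruthRelation n) where

  admitsG⇒conditions : AdmitsGConditional S ⊨ →
    (L : List (MixedRelation 𝟙 𝟘)) → IsMinimalRepresentation L ⊨ →
    DC1 (designatedSets L) × DC2 (designatedSets L) × N1 L × N2 L
  admitsG⇒conditions (f , G) L min =
    local⇒DC1 L local , local⇒DC2 L local , local⇒N1 L local anti , local⇒N2 L local
    where
    anti  = minimal⇒antichain min
    local = truthConditional⇒local (proj₁ min) anti (G⇒truthConditional S f (proj₁ min) const G)

  conditions⇒admitsG : (L : List (MixedRelation {n} 𝟙 𝟘)) → Represents L ⊨ →
    DC2 (designatedSets L) → N1 L → N2 L → AdmitsGConditional S ⊨
  conditions⇒admitsG L rep dc2 n1 n2 =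
    -- The truth function is inferred to be `implicationValue`.
    _ , truthConditional⇒G S _ rep (local⇒truthConditional rep (implicationValue-local L dc2 n1 n2))

theorem7p9 : (n : ℕ) (𝟙 𝟘 : Fin n) → 𝟙 ≢ 𝟘 →
    (S : Semantics n) → ConstantExpressive S →
    (⊨ : TruthRelation n) → IsIntersectiveMixed 𝟙 𝟘 ⊨ →
    AdmitsGConditional S ⊨ ⇔
    ((L : List (MixedRelation 𝟙 𝟘)) → IsMinimalRepresentation L ⊨ →
    DC1 (designatedSets L) × DC2 (designatedSets L) × N1 L × N2 L)
theorem7p9 n 𝟙 𝟘 _ S const ⊨ mixed = mk⇔ (admitsG⇒conditions S const ⊨) λ conditions →
  -- The conditions are granted for minimal representations, so one is first obtained by pruning the
  -- given list to an antichain.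
  let L , rep , anti = intersectiveMixed⇒antichain mixed
      dc2,n1,n2      = proj₂ (conditions L (antichain⇒minimal rep anti))
      n1,n2          = proj₂ dc2,n1,n2
  in conditions⇒admitsG S const ⊨ L rep (proj₁ dc2,n1,n2) (proj₁ n1,n2) (proj₂ n1,n2)
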